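{- Consider the following $510$ pairs of circulant graphs of order $32$, indexed by the nonempty subsets $E$ of $\{2,4,6,8,10,12,14,16\}$ ($255$ pairs in each family): (a) $C_{32}(\{1,15\}\cup E)$ and $C_{32}(\{7,9\}\cup E)$; (b) $C_{32}(\{3,13\}\cup E)$ and $C_{32}(\{5,11\}\cup E)$. Then the two graphs in each of these $510$ pairs are isomorphic, each pair is either Type-1 isomorphic or Type-2 isomorphic with respect to $m=2$, and the number of these pairs that are Type-2 isomorphic with respect to $m=2$ is exactly $384$.
   Context: For $n\ge 2$ and $R\subseteq\{1,\dots,\lfloor n/2\rfloor\}$, the circulant graph $C_n(R)$ has vertices $v_0,\dots,v_{n-1}$ (subscripts mod $n$), with $v_x$ adjacent to $v_{x+s}$ and $v_{x-s}$ for every $x\in\mathbb{Z}_n$ and $s\in R$; $C_n(r_1,\dots,r_k)$ means $C_n(\{r_1,\dots,r_k\})$. Reflexive reduction modulo $n$: each integer is reduced modulo $n$ to an element $r'$ of $\{0,\dots,n-1\}$, and $r'$ is replaced by $n-r'$ if $r'>n/2$. For an integer $y$ coprime to $n$, $yR$ denotes the set of reflexive reductions modulo $n$ of $yr$, $r\in R$. Type-1 (Adam's) isomorphism: $C_n(R)$ and $C_n(S)$ are Type-1 isomorphic if $S=yR$ for some positive integer $y$ with $\gcd(n,y)=1$. Type-2 isomorphism: let $|R|\ge 3$, $r\in R$, and let $m>1$ be such that $m$ divides $\gcd(n,r)$ and $m^3$ divides $n$. For $0\le t\le \frac{n}{m}-1$ let $\theta_{n,m,t}$ be the injective map sending $v_x$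 to $u_{x+jtm}$ (subscripts mod $n$), where $u_0,\dots,u_{n-1}$ are the vertices of $K_n$ and $x=qm+j$ with $0\le j\le m-1$, $0\le q\le \frac nm-1$; an edge $(v_x,v_{x+s})$ is sent to $(\theta_{n,m,t}(v_x),\theta_{n,m,t}(v_{x+s}))$, and $\theta_{n,m,t}(C_n(R))$ is the resulting image graph on $u_0,\dots,u_{n-1}$. We write $\theta_{n,m,t}(C_n(R))=C_n(S)$ if this image graph is the circulant graph with jump set $S$ on $u_0,\dots,u_{n-1}$ (with $u_i$ in the role of $v_i$). The graphs $C_n(R)$ and $C_n(S)$ are Type-2 isomorphic with respect to $m$ if $\theta_{n,m,t}(C_n(R))=C_n(S)$ for some such $t$ and $S\ne yR$ for every $y$ coprime to $n$. -}

module Defs where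

open import Data.Fin using (Fin; toℕ; fromℕ<)
open import Data.Fin.Subset using (Subset; _∈_; _⊆_; _∪_; Nonempty; ∣_∣)
open import Data.Integer as ℤ using (ℤ; +_)
open import Data.Integer.Coprimality using (Coprime)
open import Data.Integer.DivMod using (_%ℕ_; n%ℕd<d)
open import Data.List using (List; []; _∷_; length)
import Data.List.Membership.Propositional as List

open import Data.List.Relation.Unary.Unique.Propositional using (Unique)
open import Data.Nat using (ℕ; suc; _+_; _*_; _∸_; _^_; _≤_; _<_; _<?_; ⌊_/2⌋; NonZero; _≟_)
open import Data.List.Membership.DecPropositional _≟_ using (_∈?_)
open import Data.Nat.DivMod using (_/_; _%_)
open import Data.Nat.Divisibility using (_∣_)
open import Data.Nat.GCD using (gcd)
open import Data.Product using (Σ; ∃; ∃-syntax; _×_; _,_)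
open import Data.Sum using (_⊎_)
open import Data.Vec using (tabulate)
open import Function.Bundles using (_⇔_; _↔_; Inverse)
open import Level using (0ℓ)
open import Relation.Binary.Core using (Rel) renaming (_⇔_ to _≐₂_)
open import Relation.Binary.PropositionalEquality using (_≡_)
open import Relation.Nullary using (¬_)
open import Relation.Nullary.Decidable using (does; yes; no)
open import Relation.Unary using (Pred; _≐_)

-- The position i : Fin k of a Subset k stands for the jump i + 1, so that a Subset k
-- is a subset of {1, …, k}.
JumpSet : ℕ → Set
JumpSet n = Subset ⌊ n /2⌋

⟦_⟧ : ∀ {k} → Subset k → Pred ℕ 0ℓ
⟦ R ⟧ r = ∃[ i ] (i ∈ R × suc (toℕ i) ≡ r)

-- Entries outside {1, …, k} are dropped.
jumps : ∀ {k} → List ℕ → Subset k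
jumps rs = tabulate (λ i → does (suc (toℕ i) ∈? rs))

-- A graph on n labelled vertices is given by its adjacency relation.
Graph : ℕ → Set₁
Graph n = Rel (Fin n) 0ℓ

-- The vertex with subscript z, subscripts being read modulo n.
vertex : ∀ n .{{_ : NonZero n}} → ℤ → Fin n
vertex n z = fromℕ< (n%ℕd<d z n)

C : ∀ n .{{_ : NonZero n}} → JumpSet n → Graph n
C n R a b = ∃[ s ] (⟦ R ⟧ s ×
  (b ≡ vertex n (+ toℕ a ℤ.+ + s) ⊎ b ≡ vertex n (+ toℕ a ℤ.- + s)))

Isomorphic : ∀ {n} → Graph n → Graph n → Set
Isomorphic {n} G H =
  Σ (Fin n ↔ Fin n) λ f → ∀ x y → G x y ⇔ H (Inverse.to f x) (Inverse.to f y)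

image : ∀ {n} → (Fin n → Fin n) → Graph n → Graph n
image f G a b = ∃[ x ] ∃[ y ] (G x y × f x ≡ a × f y ≡ b)

-- The test n < 2 * r' is r' > n/2 without rounding.
reflexiveReduction : ∀ n .{{_ : NonZero n}} → ℤ → ℕ
reflexiveReduction n z with n <? 2 * (z %ℕ n)
... | yes _ = n ∸ z %ℕ n
... | no  _ = z %ℕ n

multiple : ∀ n .{{_ : NonZero n}} → ℤ → JumpSet n → Pred ℕ 0ℓ
multiple n y R k = ∃[ r ] (⟦ R ⟧ r × reflexiveReduction n (y ℤ.* + r) ≡ k)

Type1 : ∀ n .{{_ : NonZero n}} → JumpSet n → JumpSet n → Set
Type1 n R S = ∃[ y ] (0 < y × gcd n y ≡ 1 × ⟦ S ⟧ ≐ multiple n (+ y) R)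

-- For x = q m + j with 0 ≤ j < m, the index j is x % m.
θ : ∀ n m .{{_ : NonZero n}} .{{_ : NonZero m}} → ℕ → Fin n → Fin n
θ n m t x = vertex n (+ (toℕ x + (toℕ x % m) * t * m))

record Type2 (n m : ℕ) .{{_ : NonZero n}} .{{_ : NonZero m}} (R S : JumpSet n) : Set where
  field
    atLeast3  : 3 ≤ ∣ R ∣
    1<m       : 1 < m
    m∣gcd     : ∃[ r ] (⟦ R ⟧ r × m ∣ gcd n r)
    m³∣n      : m ^ 3 ∣ n
    image≐    : ∃[ t ] (t < n / m × image (θ n m t) (C n R) ≐₂ C n S)
    notAdam   : ∀ y → Coprime y (+ n) → ¬ (⟦ S ⟧ ≐ multiple n y R)

HasCardinality : {A : Set} → Pred A 0ℓ → ℕ → Set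
HasCardinality P k =
  ∃[ xs ] (Unique xs × length xs ≡ k × (∀ x → (x List.∈ xs) ⇔ P x))

evens : JumpSet 32
evens = jumps (2 ∷ 4 ∷ 6 ∷ 8 ∷ 10 ∷ 12 ∷ 14 ∷ 16 ∷ [])

data ListedPair : Pred (JumpSet 32 × JumpSet 32) 0ℓ where
  familyA : ∀ E → E ⊆ evens → Nonempty E →
            ListedPair (jumps (1 ∷ 15 ∷ []) ∪ E , jumps (7 ∷ 9 ∷ []) ∪ E)
  familyB : ∀ E → E ⊆ evens → Nonempty E →
            ListedPair (jumps (3 ∷ 13 ∷ []) ∪ E , jumps (5 ∷ 11 ∷ []) ∪ E)

{-# OPTIONS --safe #-}

-- The map θ₃₂,₂,₄ fixes the even vertices and shifts the odd ones by 8.  It commutes with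
-- every even jump and carries the jumps ±1, ±15 to ±7, ±9 and ±3, ±13 to ±5, ±11, so it is an
-- isomorphism for every pair in the list.  A multiplier y carrying the odd part of the first
-- jump set to that of the second is ±7 or ±9 modulo 32, and all four of these act on the even
-- jumps as 7 does.  Hence a pair is Type-1 isomorphic exactly when E is closed under 7, i.e.
-- when it is a union of orbits {2,14}, {4}, {6,10}, {8}, {12}, {16}.  This leaves 2⁸ − 2⁶ = 192
-- sets E, each counted once in either family.
module Submission where

open import Defs
open import Data.Fin using (Fin; toℕ)
open import Data.Fin.Properties as Fin using (toℕ-fromℕ<)
open import Data.Fin.Subset using (Subset; _∈_; _⊆_; _∪_; _∩_; ⊥; Nonempty; ∣_∣; inside; outside)
open import Data.Fin.Subset.Properties
  using (_∈?_; nonempty?; p⊆p∪q; q⊆p∪q; x∈p∪q⁻; p⊂q⇒∣p∣<∣q∣; drop-∷-⊆; out⊆; in⊆in;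
         ∪-identityˡ; ∪-distribʳ-∩)
open import Data.Integer as ℤ using (ℤ; +_)
import Data.Integer.Coprimality as ℤ
open import Data.Integer.DivMod using (_/ℕ_; _%ℕ_; n%ℕd<d; a≡a%ℕn+[a/ℕn]*n)
import Data.Integer.Properties as ℤ
open import Data.Integer.Tactic.RingSolver using (solve-∀)
open import Data.List using (List; []; _∷_; map; _++_; filter)
import Data.List.Membership.Propositional as List
open import Data.List.Membership.Propositional.Properties
  using (∈-map⁺; ∈-map⁻; ∈-++⁺ˡ; ∈-++⁺ʳ; ∈-++⁻; ∈-filter⁺; ∈-filter⁻)
open import Data.List.Relation.Unary.Any using () renaming (here to hereₗ)
open import Data.List.Relation.Unary.AllPairs using ([]; _∷_)
open import Data.List.Relation.Unary.All using ([])
open import Data.List.Relation.Unary.Unique.Propositional using (Unique)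
import Data.List.Relation.Unary.Unique.Propositional.Properties as Unique
open import Data.Nat as ℕ using (ℕ; suc; _<_; _<?_; z≤n; s≤s; NonZero)
open import Data.Nat.Base using (nonZero)
open import Data.Nat.Divisibility using (_∣_; divides; _∣?_; >⇒∤)
import Data.Nat.Properties as ℕ
open import Data.Nat.GCD using (gcd)
open import Data.Product using (_×_; _,_; proj₁; proj₂; ∃-syntax)
open import Data.Sum as Sum using (_⊎_; inj₁; inj₂; [_,_]′)
open import Data.Unit using (⊤; tt)
open import Data.Vec using ([]; _∷_; here)
import Data.Vec.Properties as Vec
open import Data.Bool using () renaming (_≟_ to _≟ᵇ_)
open import Function.Base using (_∘_; case_of_)
open import Function.Bundles using (mk⇔; mk↔ₛ′)
open import Level using (0ℓ)
open import Relation.Binary.PropositionalEquality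
  using (_≡_; refl; sym; trans; cong; subst; subst₂; module ≡-Reasoning)
open import Relation.Nullary using (¬_; Dec; yes; no; contradiction)
open import Relation.Nullary.Decidable
  using (map′; from-yes; ¬?; _×-dec_; _⊎-dec_; _→-dec_)
open import Relation.Unary using (Pred; Decidable; _≐_)

-- Residues and reflexive reduction

-- The difference of the two remainders is a multiple of `n` whose absolute value is below `n`,
-- which leaves only zero.
remainder-unique : ∀ {n r r′} i j → r < n → r′ < n →
                   + r ℤ.+ i ℤ.* + n ≡ + r′ ℤ.+ j ℤ.* + n → r ≡ r′
remainder-unique {n} {r} {r′} i j r<n r′<n eq =
  ℤ.+-injective (ℤ.i-j≡0⇒i≡j (+ r) (+ r′) (ℤ.∣i∣≡0⇒i≡0 ∣r-r′∣≡0))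
  where
  expand : ∀ a b c d n → (a ℤ.+ c ℤ.* n) ℤ.- (b ℤ.+ d ℤ.* n) ℤ.+ (d ℤ.- c) ℤ.* n ≡ a ℤ.- b
  expand = solve-∀

  r-r′≡ : + r ℤ.- + r′ ≡ (j ℤ.- i) ℤ.* + n
  r-r′≡ = begin
    + r ℤ.- + r′
      ≡⟨ expand (+ r) (+ r′) i j (+ n) ⟨
    (+ r ℤ.+ i ℤ.* + n) ℤ.- (+ r′ ℤ.+ j ℤ.* + n) ℤ.+ (j ℤ.- i) ℤ.* + n
      ≡⟨ cong (ℤ._+ (j ℤ.- i) ℤ.* + n) (ℤ.i≡j⇒i-j≡0 eq) ⟩
    + 0 ℤ.+ (j ℤ.- i) ℤ.* + n
      ≡⟨ ℤ.+-identityˡ _ ⟩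
    (j ℤ.- i) ℤ.* + n ∎
    where open ≡-Reasoning

  n∣ : n ∣ ℤ.∣ + r ℤ.- + r′ ∣
  n∣ = divides ℤ.∣ j ℤ.- i ∣ (trans (cong ℤ.∣_∣ r-r′≡) (ℤ.abs-* (j ℤ.- i) (+ n)))

  ∣r-r′∣<n : ℤ.∣ + r ℤ.- + r′ ∣ < n
  ∣r-r′∣<n = ℕ.≤-<-trans
    (subst (λ z → ℤ.∣ z ∣ ℕ.≤ r ℕ.⊔ r′) (sym (ℤ.m-n≡m⊖n r r′)) (ℤ.∣m⊝n∣≤m⊔n r r′))
    (ℕ.⊔-lub r<n r′<n)

  ∣r-r′∣≡0 : ℤ.∣ + r ℤ.- + r′ ∣ ≡ 0
  ∣r-r′∣≡0 with ℤ.∣ + r ℤ.- + r′ ∣ | n∣ | ∣r-r′∣<n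
  ... | ℕ.zero | _ | _ = refl
  ... | suc _ | n∣k | k<n = contradiction n∣k (>⇒∤ k<n)

module _ (n : ℕ) .{{_ : NonZero n}} where

  -- Together with `reflexiveReduction-cong`, this lets an arbitrary integer multiplier be replaced
  -- by its residue, so that finitely many multipliers remain to be examined.
  %ℕ-*ˡ : ∀ y z → (+ (y %ℕ n) ℤ.* z) %ℕ n ≡ (y ℤ.* z) %ℕ n
  %ℕ-*ˡ y z = remainder-unique ((x /ℕ n) ℤ.+ (y /ℕ n) ℤ.* z) ((y ℤ.* z) /ℕ n)
    (n%ℕd<d x n) (n%ℕd<d (y ℤ.* z) n) (begin
      + (x %ℕ n) ℤ.+ ((x /ℕ n) ℤ.+ (y /ℕ n) ℤ.* z) ℤ.* + n
        ≡⟨ regroup (+ (x %ℕ n)) (x /ℕ n) (y /ℕ n) z (+ n) ⟩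
      (+ (x %ℕ n) ℤ.+ (x /ℕ n) ℤ.* + n) ℤ.+ (y /ℕ n) ℤ.* + n ℤ.* z
        ≡⟨ cong (ℤ._+ (y /ℕ n) ℤ.* + n ℤ.* z) (a≡a%ℕn+[a/ℕn]*n x n) ⟨
      + (y %ℕ n) ℤ.* z ℤ.+ (y /ℕ n) ℤ.* + n ℤ.* z
        ≡⟨ ℤ.*-distribʳ-+ z (+ (y %ℕ n)) ((y /ℕ n) ℤ.* + n) ⟨
      (+ (y %ℕ n) ℤ.+ (y /ℕ n) ℤ.* + n) ℤ.* z
        ≡⟨ cong (ℤ._* z) (a≡a%ℕn+[a/ℕn]*n y n) ⟨
      y ℤ.* z
        ≡⟨ a≡a%ℕn+[a/ℕn]*n (y ℤ.* z) n ⟩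
      + ((y ℤ.* z) %ℕ n) ℤ.+ ((y ℤ.* z) /ℕ n) ℤ.* + n ∎)
    where
    open ≡-Reasoning
    x = + (y %ℕ n) ℤ.* z
    regroup : ∀ r p q z n → r ℤ.+ (p ℤ.+ q ℤ.* z) ℤ.* n ≡ (r ℤ.+ p ℤ.* n) ℤ.+ q ℤ.* n ℤ.* z
    regroup = solve-∀

  reflexiveReduction-cong : ∀ x y → x %ℕ n ≡ y %ℕ n →
                            reflexiveReduction n x ≡ reflexiveReduction n y
  reflexiveReduction-cong x y eq
    with n <? 2 ℕ.* (x %ℕ n) | n <? 2 ℕ.* (y %ℕ n)
  ... | yes _ | yes _ = cong (n ℕ.∸_) eq
  ... | no _  | no _  = eq
  ... | yes p | no ¬p = contradiction (subst (λ r → n < 2 ℕ.* r) eq p) ¬p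
  ... | no ¬p | yes p = contradiction (subst (λ r → n < 2 ℕ.* r) (sym eq) p) ¬p

-- Jump sets

module _ {k : ℕ} where

  ⟦⟧-mono : ∀ {P Q : Subset k} → P ⊆ Q → ∀ {r} → ⟦ P ⟧ r → ⟦ Q ⟧ r
  ⟦⟧-mono P⊆Q (i , i∈P , eq) = i , P⊆Q i∈P , eq

  ⟦⟧-∪⁻ : ∀ (P Q : Subset k) {r} → ⟦ P ∪ Q ⟧ r → ⟦ P ⟧ r ⊎ ⟦ Q ⟧ r
  ⟦⟧-∪⁻ P Q (i , i∈P∪Q , eq) =
    Sum.map (λ i∈P → i , i∈P , eq) (λ i∈Q → i , i∈Q , eq) (x∈p∪q⁻ P Q i∈P∪Q)

  ⟦_⟧? : ∀ (R : Subset k) → Decidable ⟦ R ⟧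
  ⟦ R ⟧? r = Fin.any? λ i → (i ∈? R) ×-dec (suc (toℕ i) ℕ.≟ r)

  -- Every jump is `suc (toℕ i)` for a position `i`, so the search through all naturals becomes a
  -- finite one.
  anyJump? : ∀ (R : Subset k) {P : Pred ℕ 0ℓ} → Decidable P → Dec (∃[ r ] (⟦ R ⟧ r × P r))
  anyJump? R P? = map′
    (λ (i , i∈R , p) → suc (toℕ i) , (i , i∈R , refl) , p)
    (λ { (_ , (i , i∈R , refl) , p) → i , i∈R , p })
    (Fin.any? λ i → (i ∈? R) ×-dec P? (suc (toℕ i)))

  allJumps? : ∀ (R : Subset k) {P : Pred ℕ 0ℓ} → Decidable P → Dec (∀ r → ⟦ R ⟧ r → P r)
  allJumps? R P? = map′
    (λ { all _ (i , i∈R , refl) → all i i∈R })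
    (λ all i i∈R → all _ (i , i∈R , refl))
    (Fin.all? λ i → (i ∈? R) →-dec P? (suc (toℕ i)))

-- Enumeration of the subsets of a finite set

subsetsOf : ∀ {k} → Subset k → List (Subset k)
subsetsOf []            = [] ∷ []
subsetsOf (outside ∷ p) = map (outside ∷_) (subsetsOf p)
subsetsOf (inside ∷ p)  = map (outside ∷_) (subsetsOf p) ++ map (inside ∷_) (subsetsOf p)

∈-subsetsOf⁺ : ∀ {k} (p : Subset k) {q} → q ⊆ p → q List.∈ subsetsOf p
∈-subsetsOf⁺ []            {[]}          q⊆p = hereₗ refl
∈-subsetsOf⁺ (outside ∷ p) {outside ∷ q} q⊆p = ∈-map⁺ _ (∈-subsetsOf⁺ p (drop-∷-⊆ q⊆p))
∈-subsetsOf⁺ (outside ∷ p) {inside ∷ q}  q⊆p = case q⊆p here of λ ()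
∈-subsetsOf⁺ (inside ∷ p)  {outside ∷ q} q⊆p =
  ∈-++⁺ˡ (∈-map⁺ _ (∈-subsetsOf⁺ p (drop-∷-⊆ q⊆p)))
∈-subsetsOf⁺ (inside ∷ p)  {inside ∷ q}  q⊆p =
  ∈-++⁺ʳ (map (outside ∷_) (subsetsOf p)) (∈-map⁺ _ (∈-subsetsOf⁺ p (drop-∷-⊆ q⊆p)))

∈-subsetsOf⁻ : ∀ {k} (p : Subset k) {q} → q List.∈ subsetsOf p → q ⊆ p
∈-subsetsOf⁻ []            {[]} _ = λ ()
∈-subsetsOf⁻ (outside ∷ p) q∈ with _ , q∈p , refl ← ∈-map⁻ _ q∈ = out⊆ (∈-subsetsOf⁻ p q∈p)
∈-subsetsOf⁻ (inside ∷ p)  q∈ with ∈-++⁻ (map (outside ∷_) (subsetsOf p)) q∈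
... | inj₁ q∈ˡ with _ , q∈p , refl ← ∈-map⁻ _ q∈ˡ = out⊆ (∈-subsetsOf⁻ p q∈p)
... | inj₂ q∈ʳ with _ , q∈p , refl ← ∈-map⁻ _ q∈ʳ = in⊆in (∈-subsetsOf⁻ p q∈p)

subsetsOf-unique : ∀ {k} (p : Subset k) → Unique (subsetsOf p)
subsetsOf-unique []            = [] ∷ []
subsetsOf-unique (outside ∷ p) = Unique.map⁺ Vec.∷-injectiveʳ (subsetsOf-unique p)
subsetsOf-unique (inside ∷ p)  = Unique.++⁺
  (Unique.map⁺ Vec.∷-injectiveʳ (subsetsOf-unique p))
  (Unique.map⁺ Vec.∷-injectiveʳ (subsetsOf-unique p))
  -- A common element would have both `outside` and `inside` as its head.
  λ (q∈ˡ , q∈ʳ) → case ∈-map⁻ _ q∈ˡ of λ { (_ , _ , refl) → case ∈-map⁻ _ q∈ʳ of λ () }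

-- Circulant graphs

module _ (n : ℕ) .{{_ : NonZero n}} where

  C-mono : ∀ {P Q} → P ⊆ Q → ∀ {a b} → C n P a b → C n Q a b
  C-mono P⊆Q (s , s∈P , b≡) = s , ⟦⟧-mono P⊆Q s∈P , b≡

  C-∪⁻ : ∀ P Q {a b} → C n (P ∪ Q) a b → C n P a b ⊎ C n Q a b
  C-∪⁻ P Q (s , s∈P∪Q , b≡) =
    Sum.map (λ s∈P → s , s∈P , b≡) (λ s∈Q → s , s∈Q , b≡) (⟦⟧-∪⁻ P Q s∈P∪Q)

  C? : ∀ R a b → Dec (C n R a b)
  C? R a b = anyJump? R λ s →
    (b Fin.≟ vertex n (+ toℕ a ℤ.+ + s)) ⊎-dec (b Fin.≟ vertex n (+ toℕ a ℤ.- + s))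

  multiple-∪⁻ : ∀ y P Q {k} → multiple n y (P ∪ Q) k → multiple n y P k ⊎ multiple n y Q k
  multiple-∪⁻ y P Q (r , r∈P∪Q , eq) =
    Sum.map (λ r∈P → r , r∈P , eq) (λ r∈Q → r , r∈Q , eq) (⟦⟧-∪⁻ P Q r∈P∪Q)

  multiple-mono : ∀ y {P Q} → P ⊆ Q → ∀ {k} → multiple n y P k → multiple n y Q k
  multiple-mono y P⊆Q (r , r∈P , eq) = r , ⟦⟧-mono P⊆Q r∈P , eq

  multiple? : ∀ y R → Decidable (multiple n y R)
  multiple? y R k = anyJump? R λ r → reflexiveReduction n (y ℤ.* + r) ℕ.≟ k

-- The order 32

infixl 7 _·_
_·_ : ℤ → ℕ → ℕ
y · r = reflexiveReduction 32 (y ℤ.* + r)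

shift : ℕ → Fin 32 → Fin 32
shift = θ 32 2

-- The maps shift 4 and shift 12 are mutually inverse, as 2 (4 + 12) = 32.
shift-4-12 : ∀ x → shift 4 (shift 12 x) ≡ x
shift-4-12 = from-yes (Fin.all? λ x → shift 4 (shift 12 x) Fin.≟ x)

shift-12-4 : ∀ x → shift 12 (shift 4 x) ≡ x
shift-12-4 = from-yes (Fin.all? λ x → shift 12 (shift 4 x) Fin.≟ x)

-- Action of the shifts on even and odd jumps

CommutesWith : ℕ → ℕ → Set
CommutesWith t s = ∀ a →
  shift t (vertex 32 (+ toℕ a ℤ.+ + s)) ≡ vertex 32 (+ toℕ (shift t a) ℤ.+ + s) ×
  shift t (vertex 32 (+ toℕ a ℤ.- + s)) ≡ vertex 32 (+ toℕ (shift t a) ℤ.- + s)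

commutesWith? : ∀ t → Decidable (CommutesWith t)
commutesWith? t s = Fin.all? λ a → (_ Fin.≟ _) ×-dec (_ Fin.≟ _)

-- An even jump preserves the parity of a vertex, and the shift moves all vertices of one parity by
-- the same amount.
shift-4-even : ∀ s → ⟦ evens ⟧ s → CommutesWith 4 s
shift-4-even = from-yes (allJumps? evens (commutesWith? 4))

shift-12-even : ∀ s → ⟦ evens ⟧ s → CommutesWith 12 s
shift-12-even = from-yes (allJumps? evens (commutesWith? 12))

-- An odd jump changes parity, so the shift alters it, and differently at even and odd vertices:
-- under `shift 4`, jump 1 becomes 9 at an even vertex and -7 at an odd one. Hence the condition
-- asks for adjacency in `C 32 Q` and not for one fixed new jump.
SendsTo : JumpSet 32 → ℕ → ℕ → Set
SendsTo Q t s = ∀ a →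
  C 32 Q (shift t a) (shift t (vertex 32 (+ toℕ a ℤ.+ + s))) ×
  C 32 Q (shift t a) (shift t (vertex 32 (+ toℕ a ℤ.- + s)))

sendsTo? : ∀ Q t → Decidable (SendsTo Q t)
sendsTo? Q t s = Fin.all? λ a → C? 32 Q _ _ ×-dec C? 32 Q _ _

-- Even jumps and the multiplier 7

2∣even : ∀ r → ⟦ evens ⟧ r → 2 ∣ gcd 32 r
2∣even = from-yes (allJumps? evens λ r → 2 ∣? gcd 32 r)

7·even : ∀ r → ⟦ evens ⟧ r → ⟦ evens ⟧ (+ 7 · r)
7·even = from-yes (allJumps? evens λ r → ⟦ evens ⟧? (+ 7 · r))

-- Here 49 ≡ 17 modulo 32, and 17 fixes every even residue since 16 times an even number vanishes
-- modulo 32.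
7·7·even : ∀ r → ⟦ evens ⟧ r → + 7 · (+ 7 · r) ≡ r
7·7·even = from-yes (allJumps? evens λ r → + 7 · (+ 7 · r) ℕ.≟ r)

7-coprime : ℤ.Coprime (+ 7) (+ 32)
7-coprime = from-yes (ℤ.coprime? (+ 7) (+ 32))

-- For `E` inside `evens` one inclusion already gives `7E = E`, because 7 acts on the even jumps as
-- an involution.
Closed : Pred (JumpSet 32) 0ℓ
Closed E = ∀ r → ⟦ E ⟧ r → ⟦ E ⟧ (+ 7 · r)

closed? : Decidable Closed
closed? E = allJumps? E λ r → ⟦ E ⟧? (+ 7 · r)

-- The second premise forces y to be odd.
SameOnEvens : JumpSet 32 → JumpSet 32 → ℤ → Set
SameOnEvens P Q y =
  (∀ r → ⟦ P ⟧ r → ⟦ Q ∪ evens ⟧ (y · r)) → (∀ k → ⟦ Q ⟧ k → multiple 32 y (P ∪ evens) k) →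
  ∀ r → ⟦ evens ⟧ r → y · r ≡ + 7 · r

sameOnEvens? : ∀ P Q → Decidable (SameOnEvens P Q)
sameOnEvens? P Q y =
  allJumps? P (λ r → ⟦ Q ∪ evens ⟧? (y · r)) →-dec
  allJumps? Q (multiple? 32 y (P ∪ evens)) →-dec
  allJumps? evens (λ r → y · r ℕ.≟ + 7 · r)

-- Collects what the argument uses about the odd parts of a pair. No field mentions `E` and each is
-- decidable, so one finite check per family serves all its pairs.
record Partners (P Q : JumpSet 32) : Set where
  field
    disjoint    : P ∩ Q ≡ ⊥
    size        : ∣ P ∣ ≡ 2
    P-odd       : ∀ r → ⟦ P ⟧ r → ¬ ⟦ evens ⟧ r
    Q-odd       : ∀ r → ⟦ Q ⟧ r → ¬ ⟦ evens ⟧ r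
    shift-P     : ∀ s → ⟦ P ⟧ s → SendsTo Q 4 s
    shift-Q     : ∀ s → ⟦ Q ⟧ s → SendsTo P 12 s
    7·P         : ∀ r → ⟦ P ⟧ r → ⟦ Q ⟧ (+ 7 · r)
    Q⊆7·P       : ∀ k → ⟦ Q ⟧ k → multiple 32 (+ 7) P k
    sameOnEvens : ∀ (y : Fin 32) → SameOnEvens P Q (+ toℕ y)

partners? : ∀ P Q → Dec (Partners P Q)
partners? P Q = map′
  (λ (a , b , c , d , e , f , g , h , i) → record
    { disjoint = a ; size = b ; P-odd = c ; Q-odd = d ; shift-P = e ; shift-Q = f
    ; 7·P = g ; Q⊆7·P = h ; sameOnEvens = i })
  (λ p → let open Partners p in
    disjoint , size , P-odd , Q-odd , shift-P , shift-Q , 7·P , Q⊆7·P , sameOnEvens)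
  (Vec.≡-dec _≟ᵇ_ (P ∩ Q) ⊥ ×-dec
   ∣ P ∣ ℕ.≟ 2 ×-dec
   allJumps? P (λ r → ¬? (⟦ evens ⟧? r)) ×-dec
   allJumps? Q (λ r → ¬? (⟦ evens ⟧? r)) ×-dec
   allJumps? P (sendsTo? Q 4) ×-dec
   allJumps? Q (sendsTo? P 12) ×-dec
   allJumps? P (λ r → ⟦ Q ⟧? (+ 7 · r)) ×-dec
   allJumps? Q (multiple? 32 (+ 7) P) ×-dec
   Fin.all? λ y → sameOnEvens? P Q (+ toℕ y))

-- The odd parts of the two families

P₁ Q₁ P₂ Q₂ : JumpSet 32
P₁ = jumps (1 ∷ 15 ∷ [])
Q₁ = jumps (7 ∷ 9 ∷ [])
P₂ = jumps (3 ∷ 13 ∷ [])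
Q₂ = jumps (5 ∷ 11 ∷ [])

partners₁ : Partners P₁ Q₁
partners₁ = from-yes (partners? P₁ Q₁)

partners₂ : Partners P₂ Q₂
partners₂ = from-yes (partners? P₂ Q₂)

-- Isomorphism types of pairs with a common even part

pair : JumpSet 32 → JumpSet 32 → JumpSet 32 → JumpSet 32 × JumpSet 32
pair P Q E = P ∪ E , Q ∪ E

module _ {P Q : JumpSet 32} (partners : Partners P Q) where
  open Partners partners

  -- As `P` and `Q` are disjoint, `E` can be recovered from the pair; hence different `E` give
  -- different pairs.
  pair-∩ : ∀ E → proj₁ (pair P Q E) ∩ proj₂ (pair P Q E) ≡ E
  pair-∩ E = begin
    (P ∪ E) ∩ (Q ∪ E) ≡⟨ ∪-distribʳ-∩ E P Q ⟨
    (P ∩ Q) ∪ E       ≡⟨ cong (_∪ E) disjoint ⟩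
    ⊥ ∪ E             ≡⟨ ∪-identityˡ E ⟩
    E                 ∎
    where open ≡-Reasoning

  pair-injective : ∀ {E E′} → pair P Q E ≡ pair P Q E′ → E ≡ E′
  pair-injective {E} {E′} eq = begin
    E                                             ≡⟨ pair-∩ E ⟨
    proj₁ (pair P Q E) ∩ proj₂ (pair P Q E)       ≡⟨ cong (λ p → proj₁ p ∩ proj₂ p) eq ⟩
    proj₁ (pair P Q E′) ∩ proj₂ (pair P Q E′)     ≡⟨ pair-∩ E′ ⟩
    E′                                            ∎
    where open ≡-Reasoning

  module _ {E : JumpSet 32} (E⊆evens : E ⊆ evens) where

    private
      R S : JumpSet 32
      R = P ∪ E
      S = Q ∪ E

      even : ∀ {r} → ⟦ E ⟧ r → ⟦ evens ⟧ r
      even = ⟦⟧-mono E⊆evens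

      E⊆R : E ⊆ R
      E⊆R = q⊆p∪q P E

      E⊆S : E ⊆ S
      E⊆S = q⊆p∪q Q E

    -- A jump from `P` is carried into `C 32 Q` by the finite check, and a jump from `E` is kept
    -- because it commutes with the shift.
    shift-4 : ∀ {a b} → C 32 R a b → C 32 S (shift 4 a) (shift 4 b)
    shift-4 {a} G with C-∪⁻ 32 P E G
    ... | inj₁ (s , s∈P , inj₁ refl) = C-mono 32 (p⊆p∪q E) (proj₁ (shift-P s s∈P a))
    ... | inj₁ (s , s∈P , inj₂ refl) = C-mono 32 (p⊆p∪q E) (proj₂ (shift-P s s∈P a))
    ... | inj₂ (s , s∈E , inj₁ refl) =
      s , ⟦⟧-mono E⊆S s∈E , inj₁ (proj₁ (shift-4-even s (even s∈E) a))
    ... | inj₂ (s , s∈E , inj₂ refl) =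
      s , ⟦⟧-mono E⊆S s∈E , inj₂ (proj₂ (shift-4-even s (even s∈E) a))

    shift-12 : ∀ {a b} → C 32 S a b → C 32 R (shift 12 a) (shift 12 b)
    shift-12 {a} H with C-∪⁻ 32 Q E H
    ... | inj₁ (s , s∈Q , inj₁ refl) = C-mono 32 (p⊆p∪q E) (proj₁ (shift-Q s s∈Q a))
    ... | inj₁ (s , s∈Q , inj₂ refl) = C-mono 32 (p⊆p∪q E) (proj₂ (shift-Q s s∈Q a))
    ... | inj₂ (s , s∈E , inj₁ refl) =
      s , ⟦⟧-mono E⊆R s∈E , inj₁ (proj₁ (shift-12-even s (even s∈E) a))
    ... | inj₂ (s , s∈E , inj₂ refl) =
      s , ⟦⟧-mono E⊆R s∈E , inj₂ (proj₂ (shift-12-even s (even s∈E) a))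

    isomorphic : Isomorphic (C 32 R) (C 32 S)
    isomorphic = mk↔ₛ′ (shift 4) (shift 12) shift-4-12 shift-12-4 , λ x y →
      -- For the converse, the inverse map is applied to an edge of `C 32 S` and the composite of
      -- the two shifts is then cancelled.
      mk⇔ shift-4 (subst₂ (C 32 R) (shift-12-4 x) (shift-12-4 y) ∘ shift-12)

    closed⇒Adam : Closed E → ⟦ S ⟧ ≐ multiple 32 (+ 7) R
    closed⇒Adam closed = S⊆7R , 7R⊆S
      where
      S⊆7R : ∀ {k} → ⟦ S ⟧ k → multiple 32 (+ 7) R k
      S⊆7R {k} k∈S with ⟦⟧-∪⁻ Q E k∈S
      ... | inj₁ k∈Q = multiple-mono 32 (+ 7) (p⊆p∪q E) (Q⊆7·P k k∈Q)
      -- The preimage of `k` under 7 is `7k` itself, by the involution.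
      ... | inj₂ k∈E = + 7 · k , ⟦⟧-mono E⊆R (closed k k∈E) , 7·7·even k (even k∈E)

      7R⊆S : ∀ {k} → multiple 32 (+ 7) R k → ⟦ S ⟧ k
      7R⊆S k∈7R with multiple-∪⁻ 32 (+ 7) P E k∈7R
      ... | inj₁ (r , r∈P , refl) = ⟦⟧-mono (p⊆p∪q E) (7·P r r∈P)
      ... | inj₂ (r , r∈E , refl) = ⟦⟧-mono E⊆S (closed r r∈E)

    -- On even jumps `y` acts as 7, so `7r` lies in `S`; being even, it cannot come from `Q` and so
    -- comes from `E`.
    Adam⇒closed : ∀ y → ⟦ S ⟧ ≐ multiple 32 y R → Closed E
    Adam⇒closed y (S⊆yR , yR⊆S) r r∈E =
      [ (λ 7r∈Q → contradiction (7·even r (even r∈E)) (Q-odd _ 7r∈Q)) , (λ 7r∈E → 7r∈E) ]′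
      (⟦⟧-∪⁻ Q E (subst ⟦ S ⟧ yr≡7r (yR⊆S (r , ⟦⟧-mono E⊆R r∈E , refl))))
      where
      -- The residue of `y` falls in the range covered by the check `sameOnEvens`.
      y′ : Fin 32
      y′ = vertex 32 y

      y′·≡y· : ∀ r → + toℕ y′ · r ≡ y · r
      y′·≡y· r = reflexiveReduction-cong 32 (+ toℕ y′ ℤ.* + r) (y ℤ.* + r)
        (trans (cong (λ u → (+ u ℤ.* + r) %ℕ 32) (toℕ-fromℕ< (n%ℕd<d y 32)))
               (%ℕ-*ˡ 32 y (+ r)))

      -- The premises of `SameOnEvens` speak of `evens` in place of `E`, so that one check covers
      -- all `E`; enlarging `E` to `evens` supplies them.
      ∪-monoʳ : ∀ T → T ∪ E ⊆ T ∪ evens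
      ∪-monoʳ T = [ p⊆p∪q evens , q⊆p∪q T evens ∘ E⊆evens ]′ ∘ x∈p∪q⁻ T E

      yr≡7r : y · r ≡ + 7 · r
      yr≡7r = trans (sym (y′·≡y· r)) (sameOnEvens y′
        (λ p p∈P → ⟦⟧-mono (∪-monoʳ Q)
          (subst ⟦ S ⟧ (sym (y′·≡y· p)) (yR⊆S (p , ⟦⟧-mono (p⊆p∪q E) p∈P , refl))))
        (λ k k∈Q → let (p , p∈R , yp≡k) = S⊆yR (⟦⟧-mono (p⊆p∪q E) k∈Q) in
          p , ⟦⟧-mono (∪-monoʳ P) p∈R , trans (y′·≡y· p) yp≡k)
        r (even r∈E))

    closed⇒Type1 : Closed E → Type1 32 R S
    closed⇒Type1 closed = 7 , s≤s z≤n , refl , closed⇒Adam closed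

    Type2⇒¬closed : Type2 32 2 R S → ¬ Closed E
    Type2⇒¬closed type2 closed = Type2.notAdam type2 (+ 7) 7-coprime (closed⇒Adam closed)

    ¬closed⇒Type2 : Nonempty E → ¬ Closed E → Type2 32 2 R S
    ¬closed⇒Type2 (i , i∈E) ¬closed = record
      -- `R` properly contains the two-element set `P`, since the even jump at `i` is missing from
      -- `P`; and `2 < ∣ R ∣` unfolds to `3 ≤ ∣ R ∣`.
      { atLeast3 = subst (_< ∣ R ∣) size (p⊂q⇒∣p∣<∣q∣ (p⊆p∪q E , i , E⊆R i∈E , i∉P))
      ; 1<m      = s≤s (s≤s z≤n)
      ; m∣gcd    = suc (toℕ i) , (i , E⊆R i∈E , refl) , 2∣even _ (even (i , i∈E , refl))
      ; m³∣n     = divides 4 refl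
      ; image≐   = 4 , from-yes (4 <? 16) , image⊆ , ⊆image
      ; notAdam  = λ y _ adam → ¬closed (Adam⇒closed y adam)
      }
      where
      i∉P : ¬ i ∈ P
      i∉P i∈P = P-odd _ (i , i∈P , refl) (even (i , i∈E , refl))

      image⊆ : ∀ {a b} → image (shift 4) (C 32 R) a b → C 32 S a b
      image⊆ (_ , _ , G , refl , refl) = shift-4 G

      ⊆image : ∀ {a b} → C 32 S a b → image (shift 4) (C 32 R) a b
      -- The inverse shift provides the preimages of both endpoints.
      ⊆image {a} {b} H = shift 12 a , shift 12 b , shift-12 H , shift-4-12 a , shift-4-12 b

    Type1⊎Type2 : Nonempty E → Type1 32 R S ⊎ Type2 32 2 R S
    Type1⊎Type2 E≢∅ with closed? E
    ... | yes closed = inj₁ (closed⇒Type1 closed)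
    ... | no ¬closed = inj₂ (¬closed⇒Type2 E≢∅ ¬closed)

-- Counting

-- The predicate is a parameter so that one construction serves both counts: the trivial predicate
-- for all pairs, non-closedness for the Type-2 pairs.
members : ∀ {U : Pred (JumpSet 32) 0ℓ} → Decidable U → List (JumpSet 32)
members U? = filter U? (filter nonempty? (subsetsOf evens))

∈-members⁺ : ∀ {U} (U? : Decidable U) {E} → E ⊆ evens → Nonempty E → U E → E List.∈ members U?
∈-members⁺ U? E⊆evens E≢∅ u =
  ∈-filter⁺ U? (∈-filter⁺ nonempty? (∈-subsetsOf⁺ evens E⊆evens) E≢∅) u

∈-members⁻ : ∀ {U} (U? : Decidable U) {E} → E List.∈ members U? → E ⊆ evens × Nonempty E × U E
∈-members⁻ U? E∈ =
  let E∈′ , u = ∈-filter⁻ U? E∈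
      E∈″ , E≢∅ = ∈-filter⁻ nonempty? E∈′
  in ∈-subsetsOf⁻ evens E∈″ , E≢∅ , u

listedPairs : ∀ {U : Pred (JumpSet 32) 0ℓ} → Decidable U → List (JumpSet 32 × JumpSet 32)
listedPairs U? = map (pair P₁ Q₁) (members U?) ++ map (pair P₂ Q₂) (members U?)

listedPairs-unique : ∀ {U} (U? : Decidable U) → Unique (listedPairs U?)
listedPairs-unique U? = Unique.++⁺
  (Unique.map⁺ (pair-injective partners₁) unique)
  (Unique.map⁺ (pair-injective partners₂) unique)
  λ (x∈ˡ , x∈ʳ) → disjoint (∈-map⁻ _ x∈ˡ) (∈-map⁻ _ x∈ʳ)
  where
  unique : Unique (members U?)
  unique = Unique.filter⁺ U? (Unique.filter⁺ nonempty? (subsetsOf-unique evens))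

  1∈P₁ : ⟦ P₁ ⟧ 1
  1∈P₁ = from-yes (⟦ P₁ ⟧? 1)

  1∉P₂∪evens : ¬ ⟦ P₂ ∪ evens ⟧ 1
  1∉P₂∪evens = from-yes (¬? (⟦ P₂ ∪ evens ⟧? 1))

  -- The jump 1 tells the families apart: it lies in the first set of every pair built from `P₁`,
  -- but neither in `P₂` nor in `evens`.
  disjoint : ∀ {x} → ∃[ E ] (E List.∈ members U? × x ≡ pair P₁ Q₁ E) →
             ¬ (∃[ E ] (E List.∈ members U? × x ≡ pair P₂ Q₂ E))
  disjoint (E , _ , refl) (E′ , E′∈ , eq) = 1∉P₂∪evens
    ([ ⟦⟧-mono (p⊆p∪q evens) , ⟦⟧-mono (q⊆p∪q P₂ evens ∘ proj₁ (∈-members⁻ U? E′∈)) ]′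
      (⟦⟧-∪⁻ P₂ E′ (subst (λ R → ⟦ R ⟧ 1) (cong proj₁ eq) (⟦⟧-mono (p⊆p∪q E) 1∈P₁))))

∈-listedPairs⁺₁ : ∀ {U} (U? : Decidable U) {E} → E ⊆ evens → Nonempty E → U E →
                  pair P₁ Q₁ E List.∈ listedPairs U?
∈-listedPairs⁺₁ U? E⊆evens E≢∅ u = ∈-++⁺ˡ (∈-map⁺ _ (∈-members⁺ U? E⊆evens E≢∅ u))

∈-listedPairs⁺₂ : ∀ {U} (U? : Decidable U) {E} → E ⊆ evens → Nonempty E → U E →
                  pair P₂ Q₂ E List.∈ listedPairs U?
∈-listedPairs⁺₂ U? E⊆evens E≢∅ u =
  ∈-++⁺ʳ (map (pair P₁ Q₁) (members U?)) (∈-map⁺ _ (∈-members⁺ U? E⊆evens E≢∅ u))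

∈-listedPairs⁻ : ∀ {U} (U? : Decidable U) {x} → x List.∈ listedPairs U? →
                 ∃[ E ] (E ⊆ evens × Nonempty E × U E × (x ≡ pair P₁ Q₁ E ⊎ x ≡ pair P₂ Q₂ E))
∈-listedPairs⁻ U? x∈ with ∈-++⁻ (map (pair P₁ Q₁) (members U?)) x∈
... | inj₁ x∈ˡ = let E , E∈ , eq = ∈-map⁻ _ x∈ˡ ; E⊆evens , E≢∅ , u = ∈-members⁻ U? E∈ in
  E , E⊆evens , E≢∅ , u , inj₁ eq
... | inj₂ x∈ʳ = let E , E∈ , eq = ∈-map⁻ _ x∈ʳ ; E⊆evens , E≢∅ , u = ∈-members⁻ U? E∈ in
  E , E⊆evens , E≢∅ , u , inj₂ eq

-- The two cardinalities

ListedPair-count : HasCardinality ListedPair 510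
-- The `refl` evaluates the length of the list, 2 (2⁸ - 1) = 510.
ListedPair-count = listedPairs true? , listedPairs-unique true? , refl , λ x → mk⇔ to from
  where
  true? : Decidable {A = JumpSet 32} (λ _ → ⊤)
  true? _ = yes tt

  to : ∀ {x} → x List.∈ listedPairs true? → ListedPair x
  to x∈ with ∈-listedPairs⁻ true? x∈
  ... | E , E⊆evens , E≢∅ , _ , inj₁ refl = familyA E E⊆evens E≢∅
  ... | E , E⊆evens , E≢∅ , _ , inj₂ refl = familyB E E⊆evens E≢∅

  from : ∀ {x} → ListedPair x → x List.∈ listedPairs true?
  from (familyA E E⊆evens E≢∅) = ∈-listedPairs⁺₁ true? E⊆evens E≢∅ tt
  from (familyB E E⊆evens E≢∅) = ∈-listedPairs⁺₂ true? E⊆evens E≢∅ tt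

-- The field `notAdam` ranges over all integers, whereas the equivalent condition that `E` is not
-- closed is decided by a finite check; filtering by it gives a list whose length evaluates to 2 (2⁸
-- - 2⁶) = 384. The empty set is among the 2⁶ closed ones, so requiring `E` nonempty removes nothing
-- further.
Type2-count : HasCardinality (λ p → ListedPair p × Type2 32 2 (proj₁ p) (proj₂ p)) 384
Type2-count = listedPairs ¬closed? , listedPairs-unique ¬closed? , refl , λ x → mk⇔ to from
  where
  ¬closed? : Decidable (λ E → ¬ Closed E)
  ¬closed? E = ¬? (closed? E)

  to : ∀ {x} → x List.∈ listedPairs ¬closed? → ListedPair x × Type2 32 2 (proj₁ x) (proj₂ x)
  to x∈ with ∈-listedPairs⁻ ¬closed? x∈
  ... | E , E⊆evens , E≢∅ , ¬closed , inj₁ refl =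
    familyA E E⊆evens E≢∅ , ¬closed⇒Type2 partners₁ E⊆evens E≢∅ ¬closed
  ... | E , E⊆evens , E≢∅ , ¬closed , inj₂ refl =
    familyB E E⊆evens E≢∅ , ¬closed⇒Type2 partners₂ E⊆evens E≢∅ ¬closed

  from : ∀ {x} → ListedPair x × Type2 32 2 (proj₁ x) (proj₂ x) → x List.∈ listedPairs ¬closed?
  from (familyA E E⊆evens E≢∅ , type2) =
    ∈-listedPairs⁺₁ ¬closed? E⊆evens E≢∅ (Type2⇒¬closed partners₁ E⊆evens type2)
  from (familyB E E⊆evens E≢∅ , type2) =
    ∈-listedPairs⁺₂ ¬closed? E⊆evens E≢∅ (Type2⇒¬closed partners₂ E⊆evens type2)

mainTheorem1 : HasCardinality ListedPair 510
    × (∀ R S → ListedPair (R , S) →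
    Isomorphic (C 32 R) (C 32 S) × (Type1 32 R S ⊎ Type2 32 2 R S))
    × HasCardinality (λ p → ListedPair p × Type2 32 2 (proj₁ p) (proj₂ p)) 384
mainTheorem1 = ListedPair-count , classify , Type2-count
  where
  classify : ∀ R S → ListedPair (R , S) →
             Isomorphic (C 32 R) (C 32 S) × (Type1 32 R S ⊎ Type2 32 2 R S)
  classify _ _ (familyA E E⊆evens E≢∅) =
    isomorphic partners₁ E⊆evens , Type1⊎Type2 partners₁ E⊆evens E≢∅
  classify _ _ (familyB E E⊆evens E≢∅) =
    isomorphic partners₂ E⊆evens , Type1⊎Type2 partners₂ E⊆evens E≢∅
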